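{- Let $G=(V,E)$ be a graph which is an $n$-convex geometry. Then $G$ admits a star if and only if $|V|$ is odd.
   Context: All graphs are finite, simple and undirected, with non-empty vertex set. For a graph $G=(V,E)$ and $x\in V$, the closed neighbourhood of $x$ is $N[x]=\{x\}\cup\{y\in V:\{x,y\}\in E\}$. A star of $G$ is a vertex $s$ with $N[s]=V$ (in particular the vertex of the one-vertex graph is a star). For $Y\subseteq V$, the common closed neighbourhood is $N[Y]=\bigcap_{y\in Y}N[y]$ if $Y\neq\varnothing$, and $N[\varnothing]=V$. The neighbourhood convexity of $G$ is the family $n_G=\{N[Y]:Y\subseteq V\}\cup\{\varnothing\}$ of subsets of $V$; it contains $\varnothing$ and $V$ and is closed under intersection. Its members are called $n$-convex sets. For $X\subseteq V$ the convex hull $[X]_{n}$ is the intersection of all $n$-convex sets containing $X$. For an $n$-convex set $K$, $\operatorname{ex}(K)=\{x\in K: K\setminus\{x\}\in n_G\}$ is the set of extreme points of $K$. $G$ is an $n$-convex geometry if $K=[\operatorname{ex}(K)]_{n}$ for every $n$-convex set $K$. -}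

module Defs where

open import Level using (0ℓ)
open import Data.Nat.Base using (ℕ)
open import Data.Fin.Base using (Fin)
open import Data.Fin.Subset using (Subset; _∈_; _-_; ⊥)
open import Data.Product.Base using (_×_; ∃-syntax)
open import Data.Sum.Base using (_⊎_)
open import Relation.Binary.Core using (Rel)
open import Relation.Binary.Definitions using (Decidable; Irreflexive; Symmetric)
open import Relation.Binary.PropositionalEquality.Core using (_≡_)
open import Relation.Unary using (Pred; Universal; _≐_)

-- Adjacency is decidable, as for any finite graph in the classical sense; this
-- makes every neighbourhood below representable as an element of Subset n.
record Graph (n : ℕ) : Set₁ where
  field
    Adj        : Rel (Fin n) 0ℓ
    adj?       : Decidable Adj
    adj-irrefl : Irreflexive _≡_ Adj
    adj-sym    : Symmetric Adj

module _ {n : ℕ} (G : Graph n) where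

  open Graph G

  ClosedNbhd : Fin n → Pred (Fin n) 0ℓ
  ClosedNbhd x y = y ≡ x ⊎ Adj x y

  IsStar : Fin n → Set
  IsStar s = Universal (ClosedNbhd s)

  -- For Y = ∅ the condition is vacuous, so N[∅] is the whole vertex set.
  CommonNbhd : Subset n → Pred (Fin n) 0ℓ
  CommonNbhd Y v = ∀ y → y ∈ Y → ClosedNbhd y v

  Convex : Subset n → Set
  Convex K = (∃[ Y ] (_∈ K) ≐ CommonNbhd Y) ⊎ K ≡ ⊥

  Hull : Pred (Fin n) 0ℓ → Pred (Fin n) 0ℓ
  Hull X v = ∀ K → Convex K → (∀ x → X x → x ∈ K) → v ∈ K

  Extreme : Subset n → Pred (Fin n) 0ℓ
  Extreme K x = x ∈ K × Convex (K - x)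

  IsConvexGeometry : Set
  IsConvexGeometry = ∀ K → Convex K → (_∈ K) ≐ Hull (Extreme K)

{-# OPTIONS --safe #-}

-- K ↦ N[K] is an antitone involution on the closed sets (those with N[N[K]] = K).
-- In a convex geometry one passes from a closed set down to any smaller one by
-- deleting one point at a time; applying N to such chains shows that
-- ∣ K ∣ + ∣ N[K] ∣ is the same for all closed K.  For K = V it is n + ∣ S ∣, with
-- S the set of stars, and for a maximal clique, where N[K] = K, it is even.  Hence
-- n and ∣ S ∣ have the same parity, and a convex geometry has at most one star.

module Submission where

open import Defs
open import Data.Nat.Base using (ℕ; NonZero; parity)
open import Data.Parity.Base using (1ℙ)
open import Data.Product.Base using (∃)
open import Function.Bundles using (_⇔_)
open import Relation.Binary.PropositionalEquality.Core using (_≡_)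

open import Data.Empty using (⊥-elim)
open import Data.Fin.Base using (Fin; zero; suc)
open import Data.Fin.Properties using (_≟_; all?; any?)
open import Data.Fin.Subset
open import Data.Fin.Subset.Induction using (Acc; acc; ⊂-wellFounded; ⊃-wellFounded)
open import Data.Fin.Subset.Properties
open import Data.Nat.Base using (suc; _+_; _≤_; s≤s)
open import Data.Nat.Properties
  using (≤-trans; ≤-reflexive; ≤-antisym; +-comm; +-suc; +-monoˡ-≤; +-monoʳ-≤; module ≤-Reasoning)
open import Data.Parity.Base using (0ℙ) renaming (_+_ to _+ℙ_)
open import Data.Parity.Properties using (+-homo-+; p+p≡0ℙ)
open import Data.Product.Base using (_×_; _,_; proj₁; proj₂)
open import Data.Sum.Base using (_⊎_; inj₁; inj₂)
open import Data.Vec.Base using (_∷_; tabulate)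
open import Data.Vec.Properties using ([]=⇒lookup; lookup⇒[]=; lookup∘tabulate)
open import Function.Base using (_∘_)
open import Function.Bundles using (mk⇔)
open import Relation.Binary.PropositionalEquality using (refl; sym; trans; cong; subst; module ≡-Reasoning)
open import Relation.Nullary.Decidable
  using (Dec; yes; no; does; map′; dec-true; decidable-stable; _×-dec_; _⊎-dec_; _→-dec_; ¬?)
open import Relation.Nullary.Negation using (contradiction)
open import Relation.Unary using (Pred; Decidable)

-- Finite subsets and parities.

module _ {n} {p} {P : Pred (Fin n) p} (P? : Decidable P) where

  comprehension : Subset n
  comprehension = tabulate (does ∘ P?)

  ∈-comprehension⁺ : ∀ {x} → P x → x ∈ comprehension
  ∈-comprehension⁺ {x} px =
    lookup⇒[]= x _ (trans (lookup∘tabulate _ x) (dec-true (P? x) px))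

  ∈-comprehension⁻ : ∀ {x} → x ∈ comprehension → P x
  ∈-comprehension⁻ {x} x∈ with P? x | trans (sym (lookup∘tabulate (does ∘ P?) x)) ([]=⇒lookup x∈)
  ... | yes px | _ = px
  ... | no _   | ()

⊈⇒∃∉ : ∀ {n} {p q : Subset n} → p ⊈ q → ∃ λ x → x ∈ p × x ∉ q
⊈⇒∃∉ {p = p} {q} p⊈q with any? (λ x → (x ∈? p) ×-dec ¬? (x ∈? q))
... | yes e  = e
... | no ¬e = ⊥-elim (p⊈q λ {x} x∈p →
  decidable-stable (x ∈? q) λ x∉q → ¬e (x , x∈p , x∉q))

⊂⇒⊉ : ∀ {n} {p q : Subset n} → p ⊂ q → q ⊈ p
⊂⇒⊉ (_ , _ , x∈q , x∉p) q⊆p = x∉p (q⊆p x∈q)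

∣p∣≤1+∣p-x∣ : ∀ {n} (p : Subset n) x → ∣ p ∣ ≤ suc ∣ p - x ∣
∣p∣≤1+∣p-x∣ (inside  ∷ p) zero    = s≤s (≤-reflexive (cong ∣_∣ (sym (p─⊥≡p p))))
∣p∣≤1+∣p-x∣ (outside ∷ p) zero    =
  ≤-trans (∣p∣≤∣x∷p∣ inside p) (s≤s (≤-reflexive (cong ∣_∣ (sym (p─⊥≡p p)))))
∣p∣≤1+∣p-x∣ (inside  ∷ p) (suc x) = s≤s (∣p∣≤1+∣p-x∣ p x)
∣p∣≤1+∣p-x∣ (outside ∷ p) (suc x) = ∣p∣≤1+∣p-x∣ p x

p+q≡0ℙ⇒p≡q : ∀ p q → p +ℙ q ≡ 0ℙ → p ≡ q
p+q≡0ℙ⇒p≡q 0ℙ 0ℙ _ = refl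
p+q≡0ℙ⇒p≡q 1ℙ 1ℙ _ = refl

-- The polarity `N`, closed sets and self-polar cliques.

module Polarity {n} (G : Graph n) where

  open Graph G

  ClosedNbhd? : ∀ x y → Dec (ClosedNbhd G x y)
  ClosedNbhd? x y = (y ≟ x) ⊎-dec adj? x y

  ClosedNbhd-sym : ∀ {x y} → ClosedNbhd G x y → ClosedNbhd G y x
  ClosedNbhd-sym (inj₁ y≡x) = inj₁ (sym y≡x)
  ClosedNbhd-sym (inj₂ xy)  = inj₂ (adj-sym xy)

  CommonNbhd? : ∀ Y → Decidable (CommonNbhd G Y)
  CommonNbhd? Y v = all? λ y → (y ∈? Y) →-dec ClosedNbhd? y v

  N : Subset n → Subset n
  N Y = comprehension (CommonNbhd? Y)

  ∈N⁺ : ∀ {Y v} → CommonNbhd G Y v → v ∈ N Y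
  ∈N⁺ {Y} = ∈-comprehension⁺ (CommonNbhd? Y)

  ∈N⁻ : ∀ {Y v} → v ∈ N Y → CommonNbhd G Y v
  ∈N⁻ {Y} = ∈-comprehension⁻ (CommonNbhd? Y)

  N-anti : ∀ {X Y} → X ⊆ Y → N Y ⊆ N X
  N-anti X⊆Y v∈NY = ∈N⁺ λ y y∈X → ∈N⁻ v∈NY y (X⊆Y y∈X)

  X⊆NNX : ∀ X → X ⊆ N (N X)
  X⊆NNX X x∈X = ∈N⁺ λ y y∈NX → ClosedNbhd-sym (∈N⁻ y∈NX _ x∈X)

  -- The reverse inclusion is `X⊆NNX`, so these are the fixed points of `N ∘ N`. `Convex` also
  -- admits `⊥`, which is closed only when there is no star, since `N (N ⊥)` is `N ⊤`.
  Closed : Subset n → Set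
  Closed K = N (N K) ⊆ K

  N-closed : ∀ Y → Closed (N Y)
  N-closed Y = N-anti (X⊆NNX Y)

  Closed⇒Convex : ∀ {K} → Closed K → Convex G K
  Closed⇒Convex {K} cl = inj₁ (N K , (λ x∈K → ∈N⁻ (X⊆NNX K x∈K)) , λ c → cl (∈N⁺ c))

  Convex⇒Closed : ∀ {K} → Convex G K → Nonempty K → Closed K
  -- Here `K` has the members of `N Y`, so `N (N K)` lies in `N (N (N Y))`, which `N-closed` returns
  -- to `N Y`.
  Convex⇒Closed {K} (inj₁ (Y , K⊆ , ⊆K)) _ v∈ =
    ⊆K (∈N⁻ (N-closed Y (N-anti (N-anti (λ x∈K → ∈N⁺ (K⊆ x∈K))) v∈)))
  Convex⇒Closed (inj₂ refl) (_ , x∈⊥) = ⊥-elim (∉⊥ x∈⊥)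

  -- For nonempty `K` the witness `Y` can be taken to be `N K`, which leaves a single inclusion to
  -- decide. This is what lets `extreme∉` search for its point.
  Convex? : ∀ K → Dec (Convex G K)
  Convex? K with nonempty? K
  ... | no ¬ne = yes (inj₂ (Empty-unique ¬ne))
  ... | yes ne = map′ Closed⇒Convex (λ c → Convex⇒Closed c ne) (N (N K) ⊆? K)

  Clique : Subset n → Set
  Clique C = C ⊆ N C

  clique-insert : ∀ {C v} → Clique C → v ∈ N C → Clique (C ∪ ⁅ v ⁆)
  clique-insert {C} {v} cl v∈NC {x} x∈ = ∈N⁺ λ y y∈ → adjacent x y (x∈p∪q⁻ C _ x∈) (x∈p∪q⁻ C _ y∈)
    where
    adjacent : ∀ x y → x ∈ C ⊎ x ∈ ⁅ v ⁆ → y ∈ C ⊎ y ∈ ⁅ v ⁆ → ClosedNbhd G y x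
    adjacent x y (inj₁ x∈C) (inj₁ y∈C) = ∈N⁻ (cl x∈C) y y∈C
    adjacent x y (inj₁ x∈C) (inj₂ y∈v) rewrite x∈⁅y⁆⇒x≡y v y∈v = ClosedNbhd-sym (∈N⁻ v∈NC x x∈C)
    adjacent x y (inj₂ x∈v) (inj₁ y∈C) rewrite x∈⁅y⁆⇒x≡y v x∈v = ∈N⁻ v∈NC y y∈C
    adjacent x y (inj₂ x∈v) (inj₂ y∈v) =
      inj₁ (trans (x∈⁅y⁆⇒x≡y v x∈v) (sym (x∈⁅y⁆⇒x≡y v y∈v)))

  -- A clique is self-polar exactly when it is maximal.
  maximalClique : ∀ C → Acc _⊃_ C → Clique C → ∃ λ K → N K ≡ K
  maximalClique C (acc rec) cl with N C ⊆? C
  ... | yes NC⊆C = C , ⊆-antisym NC⊆C cl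
  ... | no  NC⊈C with ⊈⇒∃∉ NC⊈C
  ...   | v , v∈NC , v∉C = maximalClique (C ∪ ⁅ v ⁆)
          (rec (p⊆p∪q ⁅ v ⁆ , v , q⊆p∪q C ⁅ v ⁆ (x∈⁅x⁆ v) , v∉C)) (clique-insert cl v∈NC)

  selfPolar : ∃ λ K → N K ≡ K
  selfPolar = maximalClique ⊥ (⊃-wellFounded ⊥) (λ x∈⊥ → ⊥-elim (∉⊥ x∈⊥))

  ∈N⊤⇒star : ∀ {s} → s ∈ N ⊤ → IsStar G s
  ∈N⊤⇒star s∈ y = ClosedNbhd-sym (∈N⁻ s∈ y ∈⊤)

  star⇒∈N⊤ : ∀ {s} → IsStar G s → s ∈ N ⊤
  star⇒∈N⊤ st = ∈N⁺ λ y _ → ClosedNbhd-sym (st y)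

-- Counting in a convex geometry.

module Geometry {n} (G : Graph n) (geometry : IsConvexGeometry G) where

  open Polarity G

  -- If `K` contained every extreme point of `M`, it would contain their hull, which is `M`.
  extreme∉ : ∀ {K M} → Convex G K → Convex G M → M ⊈ K → ∃ λ x → Extreme G M x × x ∉ K
  extreme∉ {K} {M} cK cM M⊈K
    with any? (λ x → ((x ∈? M) ×-dec Convex? (M - x)) ×-dec ¬? (x ∈? K))
  ... | yes e = e
  ... | no ¬e = ⊥-elim (M⊈K λ v∈M → proj₁ (geometry M cM) v∈M K cK λ x ex →
    decidable-stable (x ∈? K) λ x∉K → ¬e (x , ex , x∉K))

  weight : Subset n → ℕ
  weight K = ∣ K ∣ + ∣ N K ∣

  -- Removing an extreme point of M outside K lowers ∣ M ∣ by one, while the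
  -- polar, being injective on closed sets, grows by at least one.
  weight-anti : ∀ {K} M → Acc _⊂_ M → Closed K → Closed M → K ⊆ M → weight M ≤ weight K
  weight-anti {K} M (acc rec) clK clM K⊆M with M ⊆? K
  ... | yes M⊆K = ≤-reflexive (cong weight (⊆-antisym M⊆K K⊆M))
  ... | no  M⊈K with extreme∉ (Closed⇒Convex clK) (Closed⇒Convex clM) M⊈K
  ...   | x , (x∈M , cM′) , x∉K = begin
    ∣ M ∣ + ∣ N M ∣        ≤⟨ +-monoˡ-≤ ∣ N M ∣ (∣p∣≤1+∣p-x∣ M x) ⟩
    suc ∣ M′ ∣ + ∣ N M ∣   ≡⟨ +-suc ∣ M′ ∣ ∣ N M ∣ ⟨
    ∣ M′ ∣ + suc ∣ N M ∣   ≤⟨ +-monoʳ-≤ ∣ M′ ∣ (p⊂q⇒∣p∣<∣q∣ NM⊂NM′) ⟩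
    weight M′              ≤⟨ weight-anti M′ (rec M′⊂M) clK clM′ K⊆M′ ⟩
    weight K               ∎
    where
    open ≤-Reasoning
    M′ = M - x
    M′⊂M : M′ ⊂ M
    M′⊂M = x∈p⇒p-x⊂p x∈M
    K⊆M′ : K ⊆ M′
    K⊆M′ y∈K = x∈p∧x≢y⇒x∈p-y (K⊆M y∈K) λ y≡x → x∉K (subst (_∈ K) y≡x y∈K)
    clM′ : Closed M′
    clM′ with nonempty? M′
    ... | yes ne = Convex⇒Closed cM′ ne
    -- An empty `M′` is convex but perhaps not closed; here `K ⊆ M′` forces `M′` to equal `K`, which
    -- is closed.
    ... | no ¬ne = subst Closed (⊆-antisym K⊆M′ λ y∈ → ⊥-elim (¬ne (_ , y∈))) clK
    NM⊉NM′ : N M′ ⊈ N M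
    -- Otherwise `M ⊆ N (N M) ⊆ N (N M′) ⊆ M′`.
    NM⊉NM′ NM′⊆NM = ⊂⇒⊉ M′⊂M λ y∈M → clM′ (N-anti NM′⊆NM (X⊆NNX M y∈M))
    NM⊂NM′ : N M ⊂ N M′
    NM⊂NM′ = N-anti (proj₁ M′⊂M) , ⊈⇒∃∉ NM⊉NM′

  weight-N : ∀ {K} → Closed K → weight (N K) ≡ weight K
  weight-N {K} clK rewrite ⊆-antisym clK (X⊆NNX K) = +-comm ∣ N K ∣ ∣ K ∣

  -- `weight-anti` gives one inequality from `K ⊆ ⊤`. The other comes from `N ⊤ ⊆ N K`, because
  -- `weight-N` carries both weights across `N`.
  weight-⊤ : ∀ {K} → Closed K → weight K ≡ weight ⊤
  weight-⊤ {K} clK = ≤-antisym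
    (begin
      weight K       ≡⟨ weight-N clK ⟨
      weight (N K)   ≤⟨ weight-anti (N K) (⊂-wellFounded _) (N-closed ⊤) (N-closed K) (N-anti ⊆⊤) ⟩
      weight (N ⊤)   ≡⟨ weight-N ⊆⊤ ⟩
      weight ⊤       ∎)
    (weight-anti ⊤ (⊂-wellFounded ⊤) clK ⊆⊤ ⊆⊤)
    where open ≤-Reasoning

  parity-stars : parity n ≡ parity ∣ N ⊤ ∣
  parity-stars with selfPolar
  ... | K , NK≡K = p+q≡0ℙ⇒p≡q _ _ (begin
    parity n +ℙ parity ∣ N ⊤ ∣       ≡⟨ cong (λ m → parity m +ℙ parity ∣ N ⊤ ∣) (∣⊤∣≡n n) ⟨
    parity ∣ ⊤ {n} ∣ +ℙ parity ∣ N ⊤ ∣ ≡⟨ +-homo-+ ∣ ⊤ {n} ∣ ∣ N ⊤ ∣ ⟨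
    parity (weight ⊤)                ≡⟨ cong parity (weight-⊤ clK) ⟨
    parity (∣ K ∣ + ∣ N K ∣)         ≡⟨ cong (λ L → parity (∣ K ∣ + ∣ L ∣)) NK≡K ⟩
    parity (∣ K ∣ + ∣ K ∣)           ≡⟨ +-homo-+ ∣ K ∣ ∣ K ∣ ⟩
    parity ∣ K ∣ +ℙ parity ∣ K ∣     ≡⟨ p+p≡0ℙ (parity ∣ K ∣) ⟩
    0ℙ                               ∎)
    where
    open ≡-Reasoning
    clK : Closed K
    clK = ⊆-reflexive (trans (cong N NK≡K) NK≡K)

  -- Every nonempty convex set contains all stars, so removing an extreme star
  -- from the set of stars must leave the empty set.
  ∣stars∣≡1 : ∀ {s} → s ∈ N ⊤ → ∣ N ⊤ ∣ ≡ 1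
  ∣stars∣≡1 {s} s∈ with extreme∉ (inj₂ refl) (Closed⇒Convex (N-closed ⊤)) (λ S⊆⊥ → ∉⊥ (S⊆⊥ s∈))
  ... | x , (x∈S , cS′) , _ = ≤-antisym upper (subst (_≤ _) (∣⁅x⁆∣≡1 x) (p⊆q⇒∣p∣≤∣q∣ ⁅x⁆⊆S))
    where
    S′ = N ⊤ - x
    ⁅x⁆⊆S : ⁅ x ⁆ ⊆ N ⊤
    ⁅x⁆⊆S y∈ = subst (_∈ N ⊤) (sym (x∈⁅y⁆⇒x≡y x y∈)) x∈S
    S′≡⊥ : S′ ≡ ⊥
    -- A nonempty `S′` would be closed, and `N ⊤` lies in every polar, hence in `N (N S′)`; so `x`
    -- would be back in `S′`.
    S′≡⊥ = Empty-unique λ ne → ⊂⇒⊉ (x∈p⇒p-x⊂p x∈S) λ y∈S → Convex⇒Closed cS′ ne (N-anti ⊆⊤ y∈S)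
    upper : ∣ N ⊤ ∣ ≤ 1
    upper = ≤-trans (∣p∣≤1+∣p-x∣ (N ⊤) x) (s≤s (≤-reflexive (trans (cong ∣_∣ S′≡⊥) (∣⊥∣≡0 n))))

corollary38 : (n : ℕ) .{{_ : NonZero n}} (G : Graph n) → IsConvexGeometry G → ∃ (IsStar G) ⇔ parity n ≡ 1ℙ
corollary38 n G geometry = mk⇔ star⇒odd odd⇒star
  where
  open Polarity G
  open Geometry G geometry

  star⇒odd : ∃ (IsStar G) → parity n ≡ 1ℙ
  star⇒odd (s , st) = trans parity-stars (cong parity (∣stars∣≡1 (star⇒∈N⊤ st)))

  odd⇒star : parity n ≡ 1ℙ → ∃ (IsStar G)
  odd⇒star odd with nonempty? (N ⊤)
  ... | yes (s , s∈) = s , ∈N⊤⇒star s∈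
  ... | no ¬ne = contradiction (trans (sym odd) (trans parity-stars parity∣S∣≡0)) λ ()
    where
    parity∣S∣≡0 : parity ∣ N ⊤ ∣ ≡ 0ℙ
    parity∣S∣≡0 = cong parity (trans (cong ∣_∣ (Empty-unique ¬ne)) (∣⊥∣≡0 n))
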